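{- Let $\lambda$ and $\mu$ be partitions. The toggle map $\nu\mapsto T(\nu)$ relative to $\mu$ and $\lambda$ is a bijection from the set of partitions $\nu$ with $\mu\succ\nu\succ\lambda$ to the set of partitions $\nu'$ with $\mu\succ\nu'\succ\lambda$, and it is weight-preserving in the following manner: for every such $\nu$, $$|\nu|-|\lambda|=|\mu|-|T(\nu)|\quad\text{and}\quad|\mu|-|\nu|=|T(\nu)|-|\lambda|.$$
   Context: A partition is a weakly decreasing sequence $\lambda=(\lambda_1,\lambda_2,\dots)$ of nonnegative integers with finitely many nonzero terms; $|\lambda|=\sum_i\lambda_i$. We write $\lambda\succ\mu$ if $\lambda_1\ge\mu_1\ge\lambda_2\ge\mu_2\ge\cdots$. Toggle: for partitions $\mu\succ\nu\succ\lambda$, the toggle of $\nu$ relative to $\mu$ and $\lambda$ is the partition $T(\nu)$ given by $$T(\nu)_i=\min\{\mu_i,\lambda_{i-1}\}+\max\{\mu_{i+1},\lambda_i\}-\nu_i\qquad(i\ge1),$$ where $\lambda_0=\infty$. -}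

module Defs where

open import Data.List using (applyUpTo; sum)
open import Data.Nat using (ℕ; zero; suc; _+_; _∸_; _⊓_; _⊔_; _≤_; z≤n; s≤s)
open import Data.Nat.Properties
open import Data.Product using (Σ-syntax; _×_; _,_; proj₁; proj₂)
open import Function using (_on_)
open import Relation.Binary.Core using (Rel)
open import Relation.Binary.PropositionalEquality
  using (_≡_; refl; sym; trans; cong; cong₂; module ≡-Reasoning)

-- Indices are shifted by one: part λ i is λ_{i+1}.

record Partition : Set where
  field
    part       : ℕ → ℕ
    decreasing : ∀ i → part (suc i) ≤ part i
    bound      : ℕ
    vanishes   : ∀ {i} → bound ≤ i → part i ≡ 0

open Partition public

-- Equality of the underlying sequences.  The field bound need not be the
-- least one, so it is not part of the data being compared.

infix 4 _≈_ _≻_ _≈ᴮ_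

_≈_ : Rel Partition _
κ ≈ ν = ∀ i → part κ i ≡ part ν i

∣_∣ : Partition → ℕ
∣ ν ∣ = sum (applyUpTo (part ν) (bound ν))

_≻_ : Rel Partition _
κ ≻ ν = ∀ i → part ν i ≤ part κ i × part κ (suc i) ≤ part ν i

Between : Partition → Partition → Set
Between μ λ′ = Σ[ ν ∈ Partition ] (μ ≻ ν × ν ≻ λ′)

_≈ᴮ_ : ∀ {μ λ′} → Rel (Between μ λ′) _
_≈ᴮ_ = _≈_ on proj₁

-- upper μ λ i = min{μ_{i+1}, λ_i}; at index 0 the convention λ_0 = ∞ leaves μ_1.
-- lower μ λ i = max{μ_{i+2}, λ_{i+1}}.

upper lower : Partition → Partition → ℕ → ℕ
upper μ λ′ zero    = part μ zero
upper μ λ′ (suc i) = part μ (suc i) ⊓ part λ′ i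
lower μ λ′ i = part μ (suc i) ⊔ part λ′ i

-- Truncated subtraction is exact here whenever μ ≻ ν ≻ λ: see togglePart-exact.

togglePart : Partition → Partition → Partition → ℕ → ℕ
togglePart μ λ′ ν i = upper μ λ′ i + lower μ λ′ i ∸ part ν i

module _ (μ λ′ : Partition) (b : Between μ λ′) where

  private
    ν : Partition
    ν = proj₁ b

    μ≻ν : μ ≻ ν
    μ≻ν = proj₁ (proj₂ b)

    ν≻λ : ν ≻ λ′
    ν≻λ = proj₂ (proj₂ b)

    ν≤upper : ∀ i → part ν i ≤ upper μ λ′ i
    ν≤upper zero    = proj₁ (μ≻ν zero)
    ν≤upper (suc i) = ⊓-glb (proj₁ (μ≻ν (suc i))) (proj₂ (ν≻λ i))

    lower≤ν : ∀ i → lower μ λ′ i ≤ part ν i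
    lower≤ν i = ⊔-lub (proj₂ (μ≻ν i)) (proj₁ (ν≻λ i))

  togglePart-exact : ∀ i →
    togglePart μ λ′ ν i + part ν i ≡ upper μ λ′ i + lower μ λ′ i
  togglePart-exact i = m∸n+n≡m (≤-trans (ν≤upper i) (m≤m+n _ _))

  private
    toggle≤upper : ∀ i → togglePart μ λ′ ν i ≤ upper μ λ′ i
    toggle≤upper i = ≤-trans
      (∸-monoˡ-≤ (part ν i) (+-monoʳ-≤ (upper μ λ′ i) (lower≤ν i)))
      (≤-reflexive (m+n∸n≡m (upper μ λ′ i) (part ν i)))

    lower≤toggle : ∀ i → lower μ λ′ i ≤ togglePart μ λ′ ν i
    lower≤toggle i = ≤-trans
      (≤-reflexive (sym (m+n∸m≡n (part ν i) (lower μ λ′ i))))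
      (∸-monoˡ-≤ (part ν i) (+-monoˡ-≤ (lower μ λ′ i) (ν≤upper i)))

    upper≤μ : ∀ i → upper μ λ′ i ≤ part μ i
    upper≤μ zero    = ≤-refl
    upper≤μ (suc i) = m⊓n≤m _ _

  toggle : Partition
  toggle .part         = togglePart μ λ′ ν
  toggle .decreasing i = ≤-trans (toggle≤upper (suc i))
    (≤-trans (m⊓n≤m _ _) (≤-trans (m≤m⊔n _ _) (lower≤toggle i)))
  toggle .bound        = bound μ
  toggle .vanishes {i} b≤i = n≤0⇒n≡0 (≤-trans (toggle≤upper i)
    (≤-trans (upper≤μ i) (≤-reflexive (vanishes μ b≤i))))

-- The sum in ∣ ν ∣ does not depend on the choice of bound.

private
  sum-zero : ∀ (f : ℕ → ℕ) n → (∀ i → f i ≡ 0) → sum (applyUpTo f n) ≡ 0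
  sum-zero f zero    z = refl
  sum-zero f (suc n) z = cong₂ _+_ (z 0) (sum-zero _ n (λ i → z (suc i)))

  sum-extend : ∀ (f : ℕ → ℕ) {m n} → m ≤ n → (∀ {i} → m ≤ i → f i ≡ 0) →
    sum (applyUpTo f n) ≡ sum (applyUpTo f m)
  sum-extend f {n = n} z≤n z = sum-zero f n (λ i → z z≤n)
  sum-extend f (s≤s m≤n) z =
    cong (f 0 +_) (sum-extend (λ i → f (suc i)) m≤n (λ le → z (s≤s le)))

  sum-cong : ∀ {f g : ℕ → ℕ} → (∀ i → f i ≡ g i) → ∀ n →
    sum (applyUpTo f n) ≡ sum (applyUpTo g n)
  sum-cong e zero    = refl
  sum-cong e (suc n) = cong₂ _+_ (e 0) (sum-cong (λ i → e (suc i)) n)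

size-extend : ∀ ν {n} → bound ν ≤ n → sum (applyUpTo (part ν) n) ≡ ∣ ν ∣
size-extend ν b≤n = sum-extend (part ν) b≤n (vanishes ν)

size-cong : ∀ {κ ν} → κ ≈ ν → ∣ κ ∣ ≡ ∣ ν ∣
size-cong {κ} {ν} e = begin
  ∣ κ ∣                       ≡⟨ size-extend κ (m≤m⊔n (bound κ) (bound ν)) ⟨
  sum (applyUpTo (part κ) n)  ≡⟨ sum-cong e n ⟩
  sum (applyUpTo (part ν) n)  ≡⟨ size-extend ν (m≤n⊔m (bound κ) (bound ν)) ⟩
  ∣ ν ∣                       ∎
  where
  open ≡-Reasoning
  n = bound κ ⊔ bound ν

{-# OPTIONS --safe #-}
-- Put u = upper μ λ and l = lower μ λ.  Then ν lies between μ and λ exactly when l ≤ ν ≤ u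
-- in each part, and T(ν) + ν = u + l, so T is the reflection of these intervals: an
-- involution.  Summing T(ν) + ν = u + l over all parts and using
-- min(m, n) + max(m, n) = m + n gives |T(ν)| + |ν| = |μ| + |λ|.
module Submission where

open import Defs
open import Algebra.Properties.CommutativeSemigroup using (interchange)
open import Data.Integer using (+_; _-_; _⊖_)
open import Data.Integer.Properties using (m-n≡m⊖n; +-cancelˡ-⊖)
open import Data.List using (applyUpTo; []; _∷_; _∷ʳ_)
open import Data.List.Properties using (applyUpTo-∷ʳ)
open import Data.Nat using (ℕ; zero; suc; _+_; _∸_; _⊓_; _⊔_; _≤_)
open import Data.Nat.ListAction using (sum)
open import Data.Nat.ListAction.Properties using (sum-++)
open import Data.Nat.Properties
open import Data.Product using (Σ-syntax; _×_; _,_; proj₁; proj₂)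
open import Data.Sum using (inj₁; inj₂)
open import Function.Structures using (IsBijection)
import Relation.Binary.Construct.On as On
open import Relation.Binary.PropositionalEquality
  using (_≡_; refl; sym; trans; cong; cong₂; module ≡-Reasoning)
open import Relation.Binary.Structures using (IsEquivalence)

-- The excess of `m` over `p` equals that of `o` over `n`.
m+n≡o+p⇒n≤o⇒p≤m : ∀ {m n o p} → m + n ≡ o + p → n ≤ o → p ≤ m
m+n≡o+p⇒n≤o⇒p≤m {m} {n} {o} {p} eq n≤o = +-cancelˡ-≤ o p m (begin
  o + p  ≡⟨ eq ⟨
  m + n  ≤⟨ +-monoʳ-≤ m n≤o ⟩
  m + o  ≡⟨ +-comm m o ⟩
  o + m  ∎)
  where open ≤-Reasoning

m+n≡o+p⇒p≤n⇒m≤o : ∀ {m n o p} → m + n ≡ o + p → p ≤ n → m ≤ o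
m+n≡o+p⇒p≤n⇒m≤o {m} {n} {o} {p} eq =
  m+n≡o+p⇒n≤o⇒p≤m (trans (sym eq) (+-comm m n))

⊓+⊔≡+ : ∀ m n → m ⊓ n + (m ⊔ n) ≡ m + n
⊓+⊔≡+ m n with ≤-total m n
... | inj₁ m≤n = cong₂ _+_ (m≤n⇒m⊓n≡m m≤n) (m≤n⇒m⊔n≡n m≤n)
... | inj₂ n≤m = trans (cong₂ _+_ (m≥n⇒m⊓n≡n n≤m) (m≥n⇒m⊔n≡m n≤m)) (+-comm n m)

-- Adding `n` to both arguments of `m ⊖ p` and `p` to both arguments of `o ⊖ n` produces the same
-- pair.
m+n≡o+p⇒m-p≡o-n : ∀ m n o p → m + n ≡ o + p → + m - + p ≡ + o - + n
m+n≡o+p⇒m-p≡o-n m n o p eq = begin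
  + m - + p          ≡⟨ m-n≡m⊖n m p ⟩
  m ⊖ p              ≡⟨ +-cancelˡ-⊖ n m p ⟨
  (n + m) ⊖ (n + p)  ≡⟨ cong₂ _⊖_ (trans (+-comm n m) (trans eq (+-comm o p))) (+-comm n p) ⟩
  (p + o) ⊖ (p + n)  ≡⟨ +-cancelˡ-⊖ p o n ⟩
  o ⊖ n              ≡⟨ m-n≡m⊖n o n ⟨
  + o - + n          ∎
  where open ≡-Reasoning

sum-applyUpTo-suc : ∀ (f : ℕ → ℕ) n →
  sum (applyUpTo f (suc n)) ≡ sum (applyUpTo f n) + f n
sum-applyUpTo-suc f n = begin
  sum (applyUpTo f (suc n))          ≡⟨ cong sum (applyUpTo-∷ʳ f n) ⟨
  sum (applyUpTo f n ∷ʳ f n)         ≡⟨ sum-++ (applyUpTo f n) (f n ∷ []) ⟩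
  sum (applyUpTo f n) + (f n + 0)    ≡⟨ cong₂ _+_ refl (+-identityʳ (f n)) ⟩
  sum (applyUpTo f n) + f n          ∎
  where open ≡-Reasoning

sum-applyUpTo-cong₂ : ∀ (f g h k : ℕ → ℕ) → (∀ i → f i + g i ≡ h i + k i) → ∀ n →
  sum (applyUpTo f n) + sum (applyUpTo g n) ≡ sum (applyUpTo h n) + sum (applyUpTo k n)
sum-applyUpTo-cong₂ f g h k eq zero = refl
sum-applyUpTo-cong₂ f g h k eq (suc n) = begin
  (f 0 + _) + (g 0 + _)  ≡⟨ interchange +-commutativeSemigroup (f 0) _ (g 0) _ ⟩
  (f 0 + g 0) + _        ≡⟨ cong₂ _+_ (eq 0) (sum-applyUpTo-cong₂ _ _ _ _ (λ i → eq (suc i)) n) ⟩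
  (h 0 + k 0) + _        ≡⟨ interchange +-commutativeSemigroup (h 0) (k 0) _ _ ⟩
  (h 0 + _) + (k 0 + _)  ∎
  where open ≡-Reasoning

≈-isEquivalence : IsEquivalence _≈_
≈-isEquivalence = record
  { refl  = λ i → refl
  ; sym   = λ e i → sym (e i)
  ; trans = λ e e′ i → trans (e i) (e′ i)
  }

module _ (μ λ′ : Partition) where

  -- Interlacing never compares two parts of ν with each other, so its conditions split into one
  -- independent interval per index, and the toggle can be studied part by part.
  Bounded : Partition → Set
  Bounded ν = ∀ i → lower μ λ′ i ≤ part ν i × part ν i ≤ upper μ λ′ i

  between⇒bounded : (b : Between μ λ′) → Bounded (proj₁ b)
  between⇒bounded (ν , μ≻ν , ν≻λ) i =
    ⊔-lub (proj₂ (μ≻ν i)) (proj₁ (ν≻λ i)) , ≤upper i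
    where
    ≤upper : ∀ i → part ν i ≤ upper μ λ′ i
    ≤upper zero    = proj₁ (μ≻ν zero)
    ≤upper (suc i) = ⊓-glb (proj₁ (μ≻ν (suc i))) (proj₂ (ν≻λ i))

  bounded⇒between : ∀ {ν} → Bounded ν → μ ≻ ν × ν ≻ λ′
  bounded⇒between {ν} bd =
    (λ i → ≤-trans (proj₂ (bd i)) (upper≤μ i) , m⊔n≤o⇒m≤o _ _ (proj₁ (bd i))) ,
    -- `part λ′ i` bounds the next part of ν from above, so that inequality is found in `upper` at
    -- `suc i`.
    (λ i → m⊔n≤o⇒n≤o _ _ (proj₁ (bd i)) , m≤n⊓o⇒m≤o _ _ (proj₂ (bd (suc i))))
    where
    upper≤μ : ∀ i → upper μ λ′ i ≤ part μ i
    upper≤μ zero    = ≤-refl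
    upper≤μ (suc i) = m⊓n≤m _ _

  toggle-interlaces : (b : Between μ λ′) → μ ≻ toggle μ λ′ b × toggle μ λ′ b ≻ λ′
  -- Reflection exchanges the ends of the interval: the upper bound on ν gives the lower bound on
  -- T(ν), and conversely.
  toggle-interlaces b = bounded⇒between {toggle μ λ′ b} λ i →
    m+n≡o+p⇒n≤o⇒p≤m (togglePart-exact μ λ′ b i) (proj₂ (between⇒bounded b i)) ,
    m+n≡o+p⇒p≤n⇒m≤o (togglePart-exact μ λ′ b i) (proj₁ (between⇒bounded b i))

  toggleᴮ : Between μ λ′ → Between μ λ′
  toggleᴮ b = toggle μ λ′ b , toggle-interlaces b

  toggle-cong : ∀ {b c : Between μ λ′} → proj₁ b ≈ proj₁ c → toggle μ λ′ b ≈ toggle μ λ′ c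
  toggle-cong e i = cong (upper μ λ′ i + lower μ λ′ i ∸_) (e i)

  -- T(T(ν)) and ν both complete T(ν) to the same sum u + l, so T(ν) cancels.
  toggle-involutive : ∀ b → toggle μ λ′ (toggleᴮ b) ≈ proj₁ b
  toggle-involutive b i = +-cancelʳ-≡ t _ _ (begin
    part (toggle μ λ′ (toggleᴮ b)) i + t  ≡⟨ togglePart-exact μ λ′ (toggleᴮ b) i ⟩
    upper μ λ′ i + lower μ λ′ i           ≡⟨ togglePart-exact μ λ′ b i ⟨
    t + part (proj₁ b) i                  ≡⟨ +-comm t _ ⟩
    part (proj₁ b) i + t                  ∎)
    where
    open ≡-Reasoning
    t = part (toggle μ λ′ b) i

  toggle-isBijection : IsBijection (_≈ᴮ_ {μ} {λ′}) (_≈ᴮ_ {μ} {λ′}) toggleᴮ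
  toggle-isBijection = record
    { isInjection = record
      { isCongruent = record
        { cong           = λ {b} {c} → toggle-cong {b} {c}
        ; isEquivalence₁ = On.isEquivalence proj₁ ≈-isEquivalence
        ; isEquivalence₂ = On.isEquivalence proj₁ ≈-isEquivalence
        }
      ; injective = λ {b} {c} e i → trans (sym (toggle-involutive b i))
          (trans (toggle-cong {toggleᴮ b} {toggleᴮ c} e i) (toggle-involutive c i))
      }
    -- The preimage of `b` is its own toggle. Since equality is `_≈ᴮ_`, every `c` equivalent to that
    -- preimage must also be shown to map to `b`.
    ; surjective = λ b → toggleᴮ b , λ {c} e i →
        trans (toggle-cong {c} {toggleᴮ b} e i) (toggle-involutive b i)
    }

  -- In upper i + lower j = min(μ_{i+1}, λ_i) + max(μ_{j+2}, λ_{j+1}) the two share their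
  -- arguments when i = j + 1, so upper is summed over one part more than lower.
  sum-upper+lower : ∀ n →
    sum (applyUpTo (upper μ λ′) (suc n)) + sum (applyUpTo (lower μ λ′) n)
    ≡ sum (applyUpTo (part μ) (suc n)) + sum (applyUpTo (part λ′) n)
  sum-upper+lower n = begin
    (part μ 0 + _) + _  ≡⟨ +-assoc (part μ 0) _ _ ⟩
    part μ 0 + _        ≡⟨ cong₂ _+_ {x = part μ 0} refl
                             (sum-applyUpTo-cong₂ (λ i → upper μ λ′ (suc i)) (lower μ λ′)
                               (λ i → part μ (suc i)) (part λ′)
                               (λ i → ⊓+⊔≡+ (part μ (suc i)) (part λ′ i)) n) ⟩
    part μ 0 + _        ≡⟨ +-assoc (part μ 0) _ _ ⟨
    (part μ 0 + _) + _  ∎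
    where open ≡-Reasoning

  size-toggle : ∀ b → ∣ toggle μ λ′ b ∣ + ∣ proj₁ b ∣ ≡ ∣ μ ∣ + ∣ λ′ ∣
  size-toggle b@(ν , _) = begin
    ∣ toggle μ λ′ b ∣ + ∣ ν ∣
      ≡⟨ cong₂ _+_ (size-extend (toggle μ λ′ b) (m≤n⇒m≤1+n μ≤n))
                   (size-extend ν (m≤n⇒m≤1+n ν≤n)) ⟨
    sum (applyUpTo (part (toggle μ λ′ b)) (suc n)) + sum (applyUpTo (part ν) (suc n))
      ≡⟨ sum-applyUpTo-cong₂ (part (toggle μ λ′ b)) (part ν) (upper μ λ′) (lower μ λ′)
           (togglePart-exact μ λ′ b) (suc n) ⟩
    sum (applyUpTo (upper μ λ′) (suc n)) + sum (applyUpTo (lower μ λ′) (suc n))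
      ≡⟨ cong₂ _+_ refl lower-drop-last ⟩
    sum (applyUpTo (upper μ λ′) (suc n)) + sum (applyUpTo (lower μ λ′) n)
      ≡⟨ sum-upper+lower n ⟩
    sum (applyUpTo (part μ) (suc n)) + sum (applyUpTo (part λ′) n)
      ≡⟨ cong₂ _+_ (size-extend μ (m≤n⇒m≤1+n μ≤n)) (size-extend λ′ λ≤n) ⟩
    ∣ μ ∣ + ∣ λ′ ∣ ∎
    where
    open ≡-Reasoning
    -- Cutting a sum at `n` or `suc n` loses nothing for μ, λ, ν, nor for T(ν), whose bound is
    -- `bound μ`.
    n = bound μ ⊔ bound λ′ ⊔ bound ν

    μ≤n : bound μ ≤ n
    μ≤n = ≤-trans (m≤m⊔n _ _) (m≤m⊔n _ _)

    λ≤n : bound λ′ ≤ n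
    λ≤n = ≤-trans (m≤n⊔m (bound μ) _) (m≤m⊔n _ _)

    ν≤n : bound ν ≤ n
    ν≤n = m≤n⊔m (bound μ ⊔ bound λ′) _

    -- This is max(μ_{n+2}, λ_{n+1}), beyond both bounds. Dropping it leaves `lower` one term
    -- shorter than `upper`, as `sum-upper+lower` requires.
    lower-vanishes : lower μ λ′ n ≡ 0
    lower-vanishes = cong₂ _⊔_ (vanishes μ (m≤n⇒m≤1+n μ≤n)) (vanishes λ′ λ≤n)

    lower-drop-last : sum (applyUpTo (lower μ λ′) (suc n)) ≡ sum (applyUpTo (lower μ λ′) n)
    lower-drop-last = begin
      sum (applyUpTo (lower μ λ′) (suc n))          ≡⟨ sum-applyUpTo-suc (lower μ λ′) n ⟩
      sum (applyUpTo (lower μ λ′) n) + lower μ λ′ n ≡⟨ cong₂ _+_ refl lower-vanishes ⟩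
      sum (applyUpTo (lower μ λ′) n) + 0            ≡⟨ +-identityʳ _ ⟩
      sum (applyUpTo (lower μ λ′) n)                ∎

proposition3p5 : (μ λ′ : Partition) →
    Σ[ interlaces ∈ ((b : Between μ λ′) → μ ≻ toggle μ λ′ b × toggle μ λ′ b ≻ λ′) ]
      ( IsBijection (_≈ᴮ_ {μ} {λ′}) (_≈ᴮ_ {μ} {λ′}) (λ b → toggle μ λ′ b , interlaces b)
      × ((b : Between μ λ′) →
          (+ ∣ proj₁ b ∣ - + ∣ λ′ ∣ ≡ + ∣ μ ∣ - + ∣ toggle μ λ′ b ∣)
          × (+ ∣ μ ∣ - + ∣ proj₁ b ∣ ≡ + ∣ toggle μ λ′ b ∣ - + ∣ λ′ ∣)) )
proposition3p5 μ λ′ = toggle-interlaces μ λ′ , toggle-isBijection μ λ′ , λ b →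
  let ν = proj₁ b ; Tν = toggle μ λ′ b ; sizes = size-toggle μ λ′ b in
  -- Both weight identities rearrange the single equation |T(ν)| + |ν| = |μ| + |λ| in the integers.
  m+n≡o+p⇒m-p≡o-n (∣ ν ∣) (∣ Tν ∣) (∣ μ ∣) (∣ λ′ ∣) (trans (+-comm (∣ ν ∣) (∣ Tν ∣)) sizes) ,
  m+n≡o+p⇒m-p≡o-n (∣ μ ∣) (∣ λ′ ∣) (∣ Tν ∣) (∣ ν ∣) (sym sizes)
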